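{- For each $\delta\in\{{\tt Borda}_{\uparrow},{\tt Borda}_{\downarrow},{\tt Borda}_{av}\}$, the problems $1$-CCAC-$\delta$ and $1$-CCDC-$\delta$ can be solved in $O(n\cdot m)$ time, where $n$ is the number of votes and $m$ the number of candidates.
   Context: Let $C$ be a set of $m$ candidates. A top-truncated vote $v$ over a candidate set is a linear order of some subset of it (the ranked candidates); its length $|v|$ is the number of ranked candidates; a multiset of votes is $t$-truncated if every vote has length at most $t$. With $m$ the number of candidates currently in the election: ${\tt Borda}_{\uparrow}$: the candidate at position $i$ receives $m-i$ points, unranked candidates $0$; ${\tt Borda}_{\downarrow}$: the candidate at position $i$ receives $|v|-i+1$ points, unranked $0$; ${\tt Borda}_{av}$: the candidate at position $i$ receives $m-i$ points, each unranked candidate $\frac{m-|v|-1}{2}$. Scores are summed over votes; $c$ is the unique winner if its score strictly exceeds every other candidate's. $t$-CCAC-$\delta$: Input: disjoint candidate sets $C$ and $C^*$, $p\in C$, a multiset $V$ of $t$-truncated votes over $C\cup C^*$ (each ranks at most $t$ candidates of $C\cup C^*$), and $\ell\ge0$. Adding $C''\subseteq C^*$ yields the election with candidate set $C\cup C''$ in which each vote is restricted to $C\cup C''$ (ranked candidates from $C^*\setminus C''$ are removed, the relative order of the others kept, and the length reduced accordingly), with $m=|C\cup C''|$. Question: is there $C''\subseteq C^*$, $|C''|\le\ell$, making $p$ the unique $\delta$-winner? $t$-CCDC-$\delta$: Input: a candidate set $C$, $p\in C$, a multiset $V$ of $t$-truncated votes over $C$, and $\ell\ge0$. Question: is there $C''\subseteq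 C\setminus\{p\}$, $|C''|\le\ell$, such that $p$ is the unique $\delta$-winner of the election with candidate set $C\setminus C''$ in which each vote is restricted to $C\setminus C''$ (and $m=|C\setminus C''|$)? -}

module Defs where

open import Data.Bool.Base using (Bool; true; false; if_then_else_)
open import Data.Fin.Base using (Fin; toℕ)
import Data.Fin.Properties as Fin
open import Data.Fin.Subset using (Subset; _∈_; _⊆_; _∪_; _─_; _-_; ∁; ∣_∣; ⊤)
open import Data.Fin.Subset.Properties using (_∈?_)
open import Data.Integer.Base as ℤ using (_⊖_; 1ℤ)
open import Data.List.Base using (List; []; _∷_; _++_; map; foldr; filter; length; concatMap)
open import Data.List.Relation.Unary.All using (All)
open import Data.List.Relation.Unary.Unique.Propositional using (Unique)
open import Data.List.Relation.Unary.Unique.Propositional.Properties using (filter⁺)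
open import Data.Maybe.Base as Maybe using (Maybe; just; nothing)
open import Data.Nat.Base using (ℕ; zero; suc; _+_; _*_; _∸_; _≤_; _≡ᵇ_)
open import Data.Product.Base using (∃-syntax; _×_)
open import Data.Rational.Base as ℚ using (ℚ; 0ℚ; _/_)
open import Data.Vec.Base using (toList)
open import Function.Bundles using (_⇔_)
open import Relation.Binary.PropositionalEquality using (_≡_; _≢_)
open import Relation.Nullary.Decidable using (yes; no)

------------------------------------------------------------------------
-- Elections with top-truncated votes

-- All candidates that occur in an input are numbered, so the universe is
-- Fin m and candidate sets are subsets of it.  The head of a ranking is the
-- most preferred candidate.
record Vote (m : ℕ) : Set where
  constructor vote
  field
    ranking  : List (Fin m)
    distinct : Unique ranking

open Vote public

voteLength : ∀ {m} → Vote m → ℕ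
voteLength v = length (ranking v)

-- Multisets of votes are represented by lists.
Profile : ℕ → Set
Profile m = List (Vote m)

Truncated : ∀ {m} → ℕ → Profile m → Set
Truncated t V = All (λ v → voteLength v ≤ t) V

restrict : ∀ {m} → Subset m → Vote m → Vote m
restrict S (vote r u) = vote (filter (_∈? S) r) (filter⁺ (_∈? S) u)

-- Positions are counted from 1; nothing means unranked.
position : ∀ {m} → Fin m → List (Fin m) → Maybe ℕ
position c []      = nothing
position c (d ∷ r) with c Fin.≟ d
... | yes _ = just 1
... | no  _ = Maybe.map suc (position c r)

data Rule : Set where
  Borda↑ Borda↓ Borda-av : Rule

-- points δ m l q: points given, by a vote of length l in an election with m
-- candidates, to a candidate at position q.  _⊖_ is the integer difference
-- of two natural numbers.
points : Rule → ℕ → ℕ → Maybe ℕ → ℚ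
points Borda↑   m l (just i) = (m ⊖ i) / 1
points Borda↑   m l nothing  = 0ℚ
points Borda↓   m l (just i) = ((l ⊖ i) ℤ.+ 1ℤ) / 1
points Borda↓   m l nothing  = 0ℚ
points Borda-av m l (just i) = (m ⊖ i) / 1
points Borda-av m l nothing  = ((m ⊖ l) ℤ.- 1ℤ) / 2

-- Score of c in the election with candidate set S and each vote of V
-- restricted to S.
score : ∀ {m} → Rule → Subset m → Profile m → Fin m → ℚ
score δ S V c = foldr ℚ._+_ 0ℚ (map (λ v → given (restrict S v)) V)
  where
  given : Vote _ → ℚ
  given v = points δ ∣ S ∣ (voteLength v) (position c (ranking v))

UniqueWinner : ∀ {m} → Rule → Subset m → Profile m → Fin m → Set
UniqueWinner δ S V p =
  p ∈ S × (∀ c → c ∈ S → c ≢ p → score δ S V c ℚ.< score δ S V p)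

------------------------------------------------------------------------
-- Random access machine with unit-cost operations, as structured programs

-- reg r is one of finitely many registers occurring in the program; load e
-- reads the memory cell whose address is the value of e.  Arithmetic is
-- addition and truncated subtraction on natural numbers.
data Expr : Set where
  lit       : ℕ → Expr
  reg       : ℕ → Expr
  load      : Expr → Expr
  _⊕_ _⊝_   : Expr → Expr → Expr

infixl 6 _⊕_ _⊝_

data Program : Set where
  skip  : Program
  set   : ℕ → Expr → Program
  store : Expr → Expr → Program
  _⨾_   : Program → Program → Program
  cond  : Expr → Program → Program → Program
  while : Expr → Program → Program

infixr 5 _⨾_

record State : Set where
  constructor state
  field
    regs : ℕ → ℕ
    mem  : ℕ → ℕ

open State public

update : (ℕ → ℕ) → ℕ → ℕ → (ℕ → ℕ)
update f a x b = if a ≡ᵇ b then x else f b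

eval : State → Expr → ℕ
eval σ (lit n)  = n
eval σ (reg r)  = regs σ r
eval σ (load e) = mem σ (eval σ e)
eval σ (d ⊕ e)  = eval σ d + eval σ e
eval σ (d ⊝ e)  = eval σ d ∸ eval σ e

cost : Expr → ℕ
cost (lit n)  = 1
cost (reg r)  = 1
cost (load e) = 1 + cost e
cost (d ⊕ e)  = 1 + (cost d + cost e)
cost (d ⊝ e)  = 1 + (cost d + cost e)

-- ⟨ s , σ ⟩⇓[ k ] τ: started in σ, the program s halts in τ after k steps.
-- Tests succeed on nonzero values.
data ⟨_,_⟩⇓[_]_ : Program → State → ℕ → State → Set where
  ⇓skip  : ∀ {σ} → ⟨ skip , σ ⟩⇓[ 1 ] σ
  ⇓set   : ∀ {σ r e} →
           ⟨ set r e , σ ⟩⇓[ 1 + cost e ]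
             state (update (regs σ) r (eval σ e)) (mem σ)
  ⇓store : ∀ {σ a e} →
           ⟨ store a e , σ ⟩⇓[ 1 + (cost a + cost e) ]
             state (regs σ) (update (mem σ) (eval σ a) (eval σ e))
  ⇓seq   : ∀ {s t σ τ υ j k} →
           ⟨ s , σ ⟩⇓[ j ] τ → ⟨ t , τ ⟩⇓[ k ] υ →
           ⟨ s ⨾ t , σ ⟩⇓[ j + k ] υ
  ⇓then  : ∀ {e s t σ τ k} → eval σ e ≢ 0 →
           ⟨ s , σ ⟩⇓[ k ] τ →
           ⟨ cond e s t , σ ⟩⇓[ 1 + (cost e + k) ] τ
  ⇓else  : ∀ {e s t σ τ k} → eval σ e ≡ 0 →
           ⟨ t , σ ⟩⇓[ k ] τ →
           ⟨ cond e s t , σ ⟩⇓[ 1 + (cost e + k) ] τ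
  ⇓exit  : ∀ {e s σ} → eval σ e ≡ 0 →
           ⟨ while e s , σ ⟩⇓[ 1 + cost e ] σ
  ⇓loop  : ∀ {e s σ τ υ j k} → eval σ e ≢ 0 →
           ⟨ s , σ ⟩⇓[ j ] τ → ⟨ while e s , τ ⟩⇓[ k ] υ →
           ⟨ while e s , σ ⟩⇓[ 1 + (cost e + (j + k)) ] υ

fetch : List ℕ → ℕ → ℕ
fetch []       a       = 0
fetch (x ∷ xs) zero    = x
fetch (x ∷ xs) (suc a) = fetch xs a

-- The input occupies the memory cells from address 0 on; all other cells and
-- all registers are initially 0.
initial : List ℕ → State
initial xs = state (λ _ → 0) (fetch xs)

------------------------------------------------------------------------
-- Decision problems and running time

record Problem : Set₁ where
  field
    Instance : Set
    encode   : Instance → List ℕ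
    Yes      : Instance → Set

-- One program decides all instances, answering yes by the value 1 in
-- register 0, within c * (1 + f I) steps for a constant c.  The summand 1
-- only matters where f vanishes (elections without votes), as no program
-- halts in 0 steps.
SolvableInO : (P : Problem) → (Problem.Instance P → ℕ) → Set
SolvableInO P f =
  ∃[ prog ] ∃[ c ] ((I : Instance) →
    ∃[ k ] ∃[ τ ] (⟨ prog , initial (encode I) ⟩⇓[ k ] τ
                   × k ≤ c * (1 + f I)
                   × (regs τ 0 ≡ 1 ⇔ Yes I)))
  where open Problem P

------------------------------------------------------------------------
-- The control problems

encodeVote : ∀ {m} → Vote m → List ℕ
encodeVote v = voteLength v ∷ map toℕ (ranking v)

encodeProfile : ∀ {m} → Profile m → List ℕ
encodeProfile V = length V ∷ concatMap encodeVote V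

encodeSubset : ∀ {m} → Subset m → List ℕ
encodeSubset S = ∣ S ∣ ∷ map (λ b → if b then 1 else 0) (toList S)

-- The disjoint sets C and C* are given as a subset C of the universe
-- Fin m = C ∪ C* and its complement.
record CCACInstance (t : ℕ) : Set where
  field
    m         : ℕ
    C         : Subset m
    p         : Fin m
    p∈C       : p ∈ C
    V         : Profile m
    truncated : Truncated t V
    ℓ         : ℕ

  C* : Subset m
  C* = ∁ C

  n : ℕ
  n = length V

CCAC : ℕ → Rule → Problem
CCAC t δ = record
  { Instance = CCACInstance t
  ; encode   = λ I → let open CCACInstance I in
      m ∷ toℕ p ∷ ℓ ∷ encodeSubset C ++ encodeProfile V
  ; Yes      = λ I → let open CCACInstance I in
      ∃[ C″ ] (C″ ⊆ C* × ∣ C″ ∣ ≤ ℓ × UniqueWinner δ (C ∪ C″) V p)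
  }

record CCDCInstance (t : ℕ) : Set where
  field
    m         : ℕ
    p         : Fin m
    V         : Profile m
    truncated : Truncated t V
    ℓ         : ℕ

  C : Subset m
  C = ⊤

  n : ℕ
  n = length V

CCDC : ℕ → Rule → Problem
CCDC t δ = record
  { Instance = CCDCInstance t
  ; encode   = λ I → let open CCDCInstance I in
      m ∷ toℕ p ∷ ℓ ∷ encodeProfile V
  ; Yes      = λ I → let open CCDCInstance I in
      ∃[ C″ ] (C″ ⊆ C - p × ∣ C″ ∣ ≤ ℓ × UniqueWinner δ (C ─ C″) V p)
  }

{-# OPTIONS --safe #-}

-- A vote of length at most one gives its top candidate a fixed positive amount
-- more than every other candidate, whichever of the three rules is used and as
-- soon as two candidates compete.  Hence p is the unique winner exactly when
-- every rival has strictly fewer first places, and first places do not depend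
-- on which other candidates take part.  So adding candidates never helps, and
-- deleting helps exactly when all rivals with at least as many first places as
-- p can be deleted.  Writing B for the set of candidates (p included) that have
-- at least as many first places as p, the answer is |B| ≤ 1 for CCAC and
-- |B| ≤ 1 + ℓ for CCDC.  Recounting the votes for each candidate takes
-- O(n m) steps; without votes B is the whole candidate set, whose size is part
-- of the input, so that constant time suffices.
module Submission where

open import Algebra.Bundles using (CommutativeMonoid)
open import Data.Bool.Base using (Bool; true; false; T; _∧_; if_then_else_)
open import Data.Bool.Properties using (T-≡; T-∧)
open import Data.Fin.Base as Fin using (Fin; toℕ)
import Data.Fin.Properties as Fin
open import Data.Fin.Subset
open import Data.Fin.Subset.Properties
import Data.Integer.Base as ℤ
import Data.Integer.Properties as ℤ
open import Data.List.Base using (List; []; _∷_; _++_; map; length; concatMap)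
open import Data.List.Properties using (length-map)
open import Data.List.Relation.Unary.All using ([]; _∷_)
open import Data.Maybe.Base using (just; nothing)
open import Data.Nat.Base
open import Data.Nat.ListAction using (sum)
open import Data.Nat.Properties
open import Data.Nat.Solver using (module +-*-Solver)
open import Data.Product.Base using (_×_; _,_; proj₁; proj₂; ∃-syntax)
open import Data.Rational.Base as ℚ using (ℚ; 0ℚ; fromℚᵘ)
import Data.Rational.Properties as ℚ
open import Data.Rational.Unnormalised.Base as ℚᵘ using (mkℚᵘ)
import Data.Rational.Unnormalised.Properties as ℚᵘ
open import Data.Sum.Base using (inj₁; inj₂)
open import Data.Unit.Base using (tt)
open import Data.Vec.Base using ([]; _∷_; here; there; toList; tabulate; lookup)
open import Data.Vec.Properties using (lookup∘tabulate; []=⇒lookup; lookup⇒[]=; lookup-replicate; length-toList)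
open import Function.Base using (_∘_)
open import Function.Bundles using (_⇔_; mk⇔; Equivalence)
open import Relation.Binary.PropositionalEquality
open import Relation.Nullary using (yes; no; contradiction)
open import Defs

open import Algebra.Definitions.RawMonoid ℚ.+-0-rawMonoid using () renaming (_×_ to _·_)
open import Algebra.Properties.Monoid.Mult ℚ.+-0-monoid using (×-homo-+)
open import Algebra.Properties.CommutativeSemigroup +-commutativeSemigroup using (x∙yz≈y∙xz; x∙yz≈yx∙z)
open import Algebra.Properties.CommutativeSemigroup
  (CommutativeMonoid.commutativeSemigroup ℚ.+-0-commutativeMonoid) using (interchange)

private
  variable
    m : ℕ

-- First places decide

-- Candidates are plain numbers here because the machine tallies for the content of a register.
tops : ℕ → Vote m → ℕ
tops i (vote []      _) = 0
tops i (vote (d ∷ _) _) with toℕ d ≟ i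
... | yes _ = 1
... | no  _ = 0

votesFor : ℕ → Profile m → ℕ
votesFor i V = sum (map (tops i) V)

votesFor-no-votes : ∀ i (V : Profile m) → length V ≡ 0 → votesFor i V ≡ 0
votesFor-no-votes i [] _ = refl

gain : Rule → ℕ → ℚ
gain δ m = points δ m 1 (just 1) ℚ.- points δ m 1 nothing

-- Each `i / n` is by definition `fromℚᵘ` of a fraction, so points can be compared by cross
-- multiplication, bypassing the gcd normalisation.
fromℚᵘ-mono-< : ∀ {x y} → x ℚᵘ.< y → fromℚᵘ x ℚ.< fromℚᵘ y
fromℚᵘ-mono-< {x} {y} x<y = ℚ.toℚᵘ-cancel-<
  (ℚᵘ.<-respʳ-≃ (ℚᵘ.≃-sym (ℚ.toℚᵘ-fromℚᵘ y))
    (ℚᵘ.<-respˡ-≃ (ℚᵘ.≃-sym (ℚ.toℚᵘ-fromℚᵘ x)) x<y))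

-- With `m = k + 2` the comparisons are 0 < k + 1 for `Borda↑`, 0 < 1 for `Borda↓` and k / 2 < k + 1
-- for `Borda-av`.
unranked<ranked : ∀ δ → 2 ≤ m → points δ m 1 nothing ℚ.< points δ m 1 (just 1)
unranked<ranked Borda↑ (s≤s (s≤s {n = k} _)) =
  fromℚᵘ-mono-< {mkℚᵘ (ℤ.+ 0) 0} {mkℚᵘ (ℤ.+ suc k) 0} (ℚᵘ.*<* (ℤ.+<+ z<s))
unranked<ranked Borda↓ _ = fromℚᵘ-mono-< {mkℚᵘ (ℤ.+ 0) 0} {mkℚᵘ (ℤ.+ 1) 0} (ℚᵘ.*<* (ℤ.+<+ z<s))
unranked<ranked Borda-av (s≤s (s≤s {n = k} _)) =
  fromℚᵘ-mono-< {mkℚᵘ (ℤ.+ k) 1} {mkℚᵘ (ℤ.+ suc k) 0}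
    (ℚᵘ.*<* (subst (ℤ._< ℤ.+ suc k ℤ.* ℤ.+ 2) (ℤ.pos-* k 1)
      (ℤ.+<+ (s≤s (≤-trans (≤-reflexive (*-identityʳ k)) (≤-trans (m≤m*n k 2) (n≤1+n _)))))))

gain-positive : ∀ δ → 2 ≤ m → 0ℚ ℚ.< gain δ m
gain-positive {m} δ 2≤m =
  subst (ℚ._< gain δ m) (ℚ.+-inverseʳ lo) (ℚ.+-monoˡ-< (ℚ.- lo) (unranked<ranked δ 2≤m))
  where lo = points δ m 1 nothing

0≤· : ∀ {x} → 0ℚ ℚ.≤ x → ∀ k → 0ℚ ℚ.≤ k · x
0≤· 0≤x zero    = ℚ.≤-refl
0≤· 0≤x (suc k) = ℚ.+-mono-≤ 0≤x (0≤· 0≤x k)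

·-monoˡ-< : ∀ {x} → 0ℚ ℚ.< x → ∀ {j k} → j < k → j · x ℚ.< k · x
·-monoˡ-< 0<x {zero}  {suc k} _       = ℚ.+-mono-<-≤ 0<x (0≤· (ℚ.<⇒≤ 0<x) k)
·-monoˡ-< {x} 0<x {suc j} {suc k} (s<s j<k) = ℚ.+-monoʳ-< x (·-monoˡ-< 0<x j<k)

·-monoˡ-≤ : ∀ {x} → 0ℚ ℚ.< x → ∀ {j k} → j ≤ k → j · x ℚ.≤ k · x
·-monoˡ-≤ 0<x j≤k with m≤n⇒m<n∨m≡n j≤k
... | inj₁ j<k  = ℚ.<⇒≤ (·-monoˡ-< 0<x j<k)
... | inj₂ refl = ℚ.≤-refl

module _ (δ : Rule) (S : Subset m) where

  g : ℚ
  g = gain δ ∣ S ∣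

  -- After restriction the vote is empty and treats all members of `S` alike, or it keeps its one
  -- candidate and treats all others alike. So `b` can be chosen before `c`.
  points-affine : (v : Vote m) → voteLength v ≤ 1 → ∃[ b ] (∀ c → c ∈ S →
    points δ ∣ S ∣ (voteLength (restrict S v)) (position c (ranking (restrict S v)))
      ≡ b ℚ.+ tops (toℕ c) v · g)
  points-affine (vote [] _) _ = points δ ∣ S ∣ 0 nothing , λ _ _ → sym (ℚ.+-identityʳ _)
  points-affine (vote (_ ∷ _ ∷ _) _) (s≤s ())
  points-affine (vote (d ∷ []) u) _ with d ∈? S
  ... | no d∉S = none , absent
    where
    none = points δ ∣ S ∣ 0 nothing
    absent : ∀ c → c ∈ S → none ≡ none ℚ.+ tops (toℕ c) (vote (d ∷ []) u) · g
    absent c c∈S with toℕ d ≟ toℕ c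
    ... | yes d≡c = contradiction (subst (_∈ S) (sym (Fin.toℕ-injective d≡c)) c∈S) d∉S
    ... | no  _   = sym (ℚ.+-identityʳ _)
  ... | yes _ = lo , present
    where
    lo = points δ ∣ S ∣ 1 nothing
    hi = points δ ∣ S ∣ 1 (just 1)
    present : ∀ c → c ∈ S → points δ ∣ S ∣ 1 (position c (d ∷ []))
      ≡ lo ℚ.+ tops (toℕ c) (vote (d ∷ []) u) · g
    present c _ with c Fin.≟ d | toℕ d ≟ toℕ c
    ... | yes _   | yes _   = sym (begin
      lo ℚ.+ (hi ℚ.- lo ℚ.+ 0ℚ)   ≡⟨ cong (lo ℚ.+_) (ℚ.+-identityʳ (hi ℚ.- lo)) ⟩
      lo ℚ.+ (hi ℚ.- lo)          ≡⟨ cong (lo ℚ.+_) (ℚ.+-comm hi (ℚ.- lo)) ⟩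
      lo ℚ.+ (ℚ.- lo ℚ.+ hi)      ≡⟨ ℚ.+-assoc lo (ℚ.- lo) hi ⟨
      lo ℚ.- lo ℚ.+ hi            ≡⟨ cong (ℚ._+ hi) (ℚ.+-inverseʳ lo) ⟩
      0ℚ ℚ.+ hi                   ≡⟨ ℚ.+-identityˡ hi ⟩
      hi                          ∎)
      where open ≡-Reasoning
    ... | yes c≡d | no d≢c  = contradiction (cong toℕ (sym c≡d)) d≢c
    ... | no c≢d  | yes d≡c = contradiction (sym (Fin.toℕ-injective d≡c)) c≢d
    ... | no _    | no _    = sym (ℚ.+-identityʳ lo)

  score-affine : (V : Profile m) → Truncated 1 V → ∃[ b ] (∀ c → c ∈ S →
    score δ S V c ≡ b ℚ.+ votesFor (toℕ c) V · g)
  score-affine []      []       = 0ℚ , λ _ _ → refl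
  score-affine (v ∷ V) (t ∷ ts) with points-affine v t | score-affine V ts
  ... | b , pt | b′ , sc = b ℚ.+ b′ , λ c c∈S → begin
    _                                     ≡⟨ cong₂ ℚ._+_ (pt c c∈S) (sc c c∈S) ⟩
    (b ℚ.+ i c · g) ℚ.+ (b′ ℚ.+ j c · g)  ≡⟨ interchange b (i c · g) b′ (j c · g) ⟩
    (b ℚ.+ b′) ℚ.+ (i c · g ℚ.+ j c · g)  ≡⟨ cong ((b ℚ.+ b′) ℚ.+_) (×-homo-+ g (i c) (j c)) ⟨
    (b ℚ.+ b′) ℚ.+ (i c + j c) · g        ∎
    where
    open ≡-Reasoning
    i j : Fin m → ℕ
    i c = tops (toℕ c) v
    j c = votesFor (toℕ c) V

Beats : Profile m → Subset m → Fin m → Set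
Beats V S p = ∀ c → c ∈ S → c ≢ p → votesFor (toℕ c) V < votesFor (toℕ p) V

-- Any rival whose score is compared with that of `p` thus provides the hypothesis of
-- `gain-positive`.
two-members : {S : Subset m} {c p : Fin m} → c ∈ S → p ∈ S → c ≢ p → 2 ≤ ∣ S ∣
two-members c∈S p∈S c≢p =
  ≤-trans (s≤s (≤-<-trans z≤n (x∈p⇒∣p-x∣<∣p∣ (x∈p∧x≢y⇒x∈p-y c∈S c≢p)))) (x∈p⇒∣p-x∣<∣p∣ p∈S)

-- The base `b` is common to all scores and cancels, and multiplying by a positive gain is monotone.
-- The forward direction is by contraposition.
uniqueWinner⇔beats : ∀ δ {S : Subset m} {V p} → Truncated 1 V →
  UniqueWinner δ S V p ⇔ (p ∈ S × Beats V S p)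
uniqueWinner⇔beats δ {S} {V} {p} ts with score-affine δ S V ts
... | b , sc = mk⇔
  (λ (p∈S , win) → p∈S , λ c c∈S c≢p → ≰⇒> λ p≤c → ℚ.<-irrefl refl (ℚ.<-≤-trans (win c c∈S c≢p)
    (subst₂ ℚ._≤_ (sym (sc p p∈S)) (sym (sc c c∈S))
      (ℚ.+-monoʳ-≤ b (·-monoˡ-≤ (gain-positive δ (two-members c∈S p∈S c≢p)) p≤c)))))
  (λ (p∈S , beats) → p∈S , λ c c∈S c≢p →
    subst₂ ℚ._<_ (sym (sc c c∈S)) (sym (sc p p∈S))
      (ℚ.+-monoʳ-< b (·-monoˡ-< (gain-positive δ (two-members c∈S p∈S c≢p)) (beats c c∈S c≢p))))

-- Control by adding and deleting candidates

-- `B` is described by its membership instead of being built, so that the set tabulated from the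
-- machine's test can take its place.
record Threats (V : Profile m) (C : Subset m) (p : Fin m) (B : Subset m) : Set where
  constructor mkThreats
  field
    threat : ∀ c → c ∈ B ⇔ (c ∈ C × votesFor (toℕ p) V ≤ votesFor (toℕ c) V)

open Threats

x∈p─q⇒x∉q : ∀ {p q : Subset m} {x} → x ∈ p ─ q → x ∉ q
x∈p─q⇒x∉q {p = _ ∷ p} {q = _ ∷ q} (there x∈p─q) (there x∈q) = x∈p─q⇒x∉q x∈p─q x∈q
x∈p─q⇒x∉q {p = inside  ∷ p} {q = inside ∷ q} () here
x∈p─q⇒x∉q {p = outside ∷ p} {q = inside ∷ q} () here

∣p∪q∣≤∣p∣+∣q∣ : ∀ (p q : Subset m) → ∣ p ∪ q ∣ ≤ ∣ p ∣ + ∣ q ∣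
∣p∪q∣≤∣p∣+∣q∣ []            []            = z≤n
∣p∪q∣≤∣p∣+∣q∣ (outside ∷ p) (outside ∷ q) = ∣p∪q∣≤∣p∣+∣q∣ p q
∣p∪q∣≤∣p∣+∣q∣ (inside  ∷ p) (outside ∷ q) = s≤s (∣p∪q∣≤∣p∣+∣q∣ p q)
∣p∪q∣≤∣p∣+∣q∣ (outside ∷ p) (inside  ∷ q) =
  ≤-trans (s≤s (∣p∪q∣≤∣p∣+∣q∣ p q)) (≤-reflexive (sym (+-suc ∣ p ∣ ∣ q ∣)))
∣p∪q∣≤∣p∣+∣q∣ (inside  ∷ p) (inside  ∷ q) =
  s≤s (≤-trans (∣p∪q∣≤∣p∣+∣q∣ p q) (+-monoʳ-≤ ∣ p ∣ (n≤1+n ∣ q ∣)))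

module _ {V : Profile m} {C B : Subset m} {p : Fin m} (p∈C : p ∈ C) (threats : Threats V C p B) where

  p∈B : p ∈ B
  p∈B = Equivalence.from (threat threats p) (p∈C , ≤-refl)

  beats-outside : ∀ {c} → c ∈ C → c ∉ B → votesFor (toℕ c) V < votesFor (toℕ p) V
  beats-outside {c} c∈C c∉B = ≰⇒> λ p≤c → c∉B (Equivalence.from (threat threats c) (c∈C , p≤c))

  -- A threat other than `p` must lie in `D`, whence `B ⊆ ⁅ p ⁆ ∪ D`. The set `D` stands for the
  -- deleted candidates.
  threats-bound : ∀ {D} → (∀ c → c ∈ C → c ∉ D → c ≢ p → votesFor (toℕ c) V < votesFor (toℕ p) V) →
    ∣ B ∣ ≤ suc ∣ D ∣
  threats-bound {D} beats = ≤-trans (p⊆q⇒∣p∣≤∣q∣ B⊆)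
    (≤-trans (∣p∪q∣≤∣p∣+∣q∣ ⁅ p ⁆ D) (≤-reflexive (cong (_+ ∣ D ∣) (∣⁅x⁆∣≡1 p))))
    where
    B⊆ : B ⊆ ⁅ p ⁆ ∪ D
    B⊆ {c} c∈B with c Fin.≟ p | c ∈? D
    ... | yes refl | _       = x∈p∪q⁺ (inj₁ (x∈⁅x⁆ p))
    ... | no  _    | yes c∈D = x∈p∪q⁺ (inj₂ c∈D)
    ... | no  c≢p  | no  c∉D with Equivalence.to (threat threats c) c∈B
    ... | c∈C , p≤c = contradiction (beats c c∈C c∉D c≢p) (≤⇒≯ p≤c)

  -- All counts are 0, so everyone in `C` is a threat. This justifies answering without a loop when
  -- there are no votes.
  no-votes⇒∣B∣≡∣C∣ : length V ≡ 0 → ∣ B ∣ ≡ ∣ C ∣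
  no-votes⇒∣B∣≡∣C∣ n≡0 = ≤-antisym
    (p⊆q⇒∣p∣≤∣q∣ λ {c} c∈B → proj₁ (Equivalence.to (threat threats c) c∈B))
    (p⊆q⇒∣p∣≤∣q∣ λ {c} c∈C → Equivalence.from (threat threats c)
      (c∈C , ≤-trans (≤-reflexive (votesFor-no-votes (toℕ p) V n≡0)) z≤n))

ccac-yes⇔ : ∀ δ (I : CCACInstance 1) → let open CCACInstance I in ∀ {B} → Threats V C p B →
  Problem.Yes (CCAC 1 δ) I ⇔ ∣ B ∣ ≤ 1
ccac-yes⇔ δ I {B} threats = mk⇔ sound complete
  where
  open CCACInstance I
  sound : Problem.Yes (CCAC 1 δ) I → ∣ B ∣ ≤ 1
  -- Adding removes no rival in `C`, so `D` is empty.
  sound (C″ , _ , _ , win) = subst (λ k → ∣ B ∣ ≤ suc k) (∣⊥∣≡0 (CCACInstance.m I))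
    (threats-bound p∈C threats {⊥} λ c c∈C _ →
      proj₂ (Equivalence.to (uniqueWinner⇔beats δ truncated) win) c (x∈p∪q⁺ (inj₁ c∈C)))
  complete : ∣ B ∣ ≤ 1 → Problem.Yes (CCAC 1 δ) I
  -- Adding nobody works: `p` already fills `B`, so no rival is in it.
  complete ∣B∣≤1 = ⊥ , (λ c∈⊥ → contradiction c∈⊥ ∉⊥) , subst (_≤ ℓ) (sym (∣⊥∣≡0 (CCACInstance.m I))) z≤n ,
    Equivalence.from (uniqueWinner⇔beats δ truncated)
      (x∈p∪q⁺ (inj₁ p∈C) , λ c c∈C∪⊥ c≢p →
        beats-outside p∈C threats (subst (c ∈_) (∪-identityʳ C) c∈C∪⊥)
          λ c∈B → ≤⇒≯ ∣B∣≤1 (two-members c∈B (p∈B p∈C threats) c≢p))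

ccdc-yes⇔ : ∀ δ (I : CCDCInstance 1) → let open CCDCInstance I in ∀ {B} → Threats V C p B →
  Problem.Yes (CCDC 1 δ) I ⇔ ∣ B ∣ ≤ suc ℓ
ccdc-yes⇔ δ I {B} threats = mk⇔ sound complete
  where
  open CCDCInstance I
  sound : Problem.Yes (CCDC 1 δ) I → ∣ B ∣ ≤ suc ℓ
  sound (C″ , _ , ∣C″∣≤ℓ , win) = ≤-trans
    (threats-bound ∈⊤ threats λ c c∈C c∉C″ →
      proj₂ (Equivalence.to (uniqueWinner⇔beats δ truncated) win) c (x∈p∧x∉q⇒x∈p─q c∈C c∉C″))
    (s≤s ∣C″∣≤ℓ)
  complete : ∣ B ∣ ≤ suc ℓ → Problem.Yes (CCDC 1 δ) I
  complete ∣B∣≤ =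
    -- All threats but `p` are deleted; as `p` is in `B`, these are at most `ℓ`.
    B - p
    , (λ c∈B-p → x∈p∧x∉q⇒x∈p─q ∈⊤ (x∈p─q⇒x∉q {p = B} c∈B-p))
    , s≤s⁻¹ (≤-trans (x∈p⇒∣p-x∣<∣p∣ (p∈B ∈⊤ threats)) ∣B∣≤)
    , Equivalence.from (uniqueWinner⇔beats δ truncated)
        ( x∈p∧x∉q⇒x∈p─q ∈⊤ (λ p∈B-p → x∈p─q⇒x∉q {p = B} p∈B-p (x∈⁅x⁆ p))
        , λ c c∈ c≢p → beats-outside ∈⊤ threats ∈⊤
            λ c∈B → x∈p─q⇒x∉q {p = ⊤} c∈ (x∈p∧x≢y⇒x∈p-y c∈B c≢p))

-- Running programs

-- A total-correctness Hoare triple with a time budget. As `K` is only an upper bound, branches of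
-- unequal cost can share it.
Runs : Program → State → ℕ → (State → Set) → Set
Runs s σ K Q = ∃[ k ] ∃[ τ ] (⟨ s , σ ⟩⇓[ k ] τ × k ≤ K × Q τ)

assign : State → ℕ → Expr → State
assign σ r e = state (update (regs σ) r (eval σ e)) (mem σ)

private
  variable
    s t : Program
    e : Expr
    σ : State
    K L : ℕ
    P Q : State → Set

runs-≤ : K ≤ L → Runs s σ K Q → Runs s σ L Q
runs-≤ K≤L (k , τ , run , k≤K , q) = k , τ , run , ≤-trans k≤K K≤L , q

runs-map : (∀ τ → P τ → Q τ) → Runs s σ K P → Runs s σ K Q
runs-map P⇒Q (k , τ , run , k≤K , p) = k , τ , run , k≤K , P⇒Q τ p

runs-skip : Q σ → Runs skip σ 1 Q
runs-skip q = _ , _ , ⇓skip , ≤-refl , q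

runs-set : ∀ {r} → Q (assign σ r e) → Runs (set r e) σ (1 + cost e) Q
runs-set q = _ , _ , ⇓set , ≤-refl , q

runs-⨾ : Runs s σ K P → (∀ τ → P τ → Runs t τ L Q) → Runs (s ⨾ t) σ (K + L) Q
runs-⨾ (k , τ , run , k≤K , p) next with next τ p
... | l , υ , run′ , l≤L , q = k + l , υ , ⇓seq run run′ , +-mono-≤ k≤K l≤L , q

runs-set-⨾ : ∀ {r} → Runs t (assign σ r e) K Q → Runs (set r e ⨾ t) σ (1 + cost e + K) Q
runs-set-⨾ {e = e} (k , τ , run , k≤K , q) =
  1 + cost e + k , τ , ⇓seq ⇓set run , +-monoʳ-≤ (1 + cost e) k≤K , q

runs-then : eval σ e ≢ 0 → Runs s σ K Q → Runs (cond e s t) σ (1 + (cost e + K)) Q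
runs-then {e = e} e≢0 (k , τ , run , k≤K , q) =
  _ , τ , ⇓then e≢0 run , s≤s (+-monoʳ-≤ (cost e) k≤K) , q

runs-else : eval σ e ≡ 0 → Runs t σ K Q → Runs (cond e s t) σ (1 + (cost e + K)) Q
runs-else {e = e} e≡0 (k , τ , run , k≤K , q) =
  _ , τ , ⇓else e≡0 run , s≤s (+-monoʳ-≤ (cost e) k≤K) , q

runs-exit : eval σ e ≡ 0 → Q σ → Runs (while e s) σ (1 + cost e) Q
runs-exit e≡0 q = _ , _ , ⇓exit e≡0 , ≤-refl , q

runs-loop : eval σ e ≢ 0 → Runs s σ K P → (∀ τ → P τ → Runs (while e s) τ L Q) →
  Runs (while e s) σ (1 + (cost e + (K + L))) Q
runs-loop {e = e} e≢0 (k , τ , run , k≤K , p) next with next τ p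
... | l , υ , run′ , l≤L , q =
  _ , υ , ⇓loop e≢0 run run′ , s≤s (+-monoʳ-≤ (cost e) (+-mono-≤ k≤K l≤L)) , q

-- Memory contents

-- As `fetch` gives 0 past the end, every cell from `a` on is fixed. The form `j + a` makes the
-- first two addresses agree by computation with those that `scanVote` evaluates.
record Stored (M : ℕ → ℕ) (a : ℕ) (xs : List ℕ) : Set where
  constructor stored
  field
    cell : ∀ j → M (j + a) ≡ fetch xs j

open Stored

stored-tail : ∀ {M a x xs} → Stored M a (x ∷ xs) → Stored M (suc a) xs
stored-tail {M} {a} st .cell j = trans (cong M (+-suc j a)) (cell st (suc j))

stored-++ : ∀ {M a} xs {ys} → Stored M a (xs ++ ys) → Stored M (length xs + a) ys
stored-++ {M} {a} []       st = st
stored-++ {M} {a} (x ∷ xs) {ys} st =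
  subst (λ b → Stored M b ys) (+-suc (length xs) a) (stored-++ xs (stored-tail st))

fetch-bits : (C : Subset m) (c : Fin m) → ∀ {ys} →
  fetch (map (λ b → if b then 1 else 0) (toList C) ++ ys) (toℕ c) ≡ (if lookup C c then 1 else 0)
fetch-bits (_ ∷ C) Fin.zero    = refl
fetch-bits (_ ∷ C) (Fin.suc c) = fetch-bits C c

-- Registers: 1 tally, 2 address of the next vote, 3 votes left, 4 candidate,
-- 5 tally of p, 6 result, 7 largest accepted result, 8 number of votes,
-- 9 address of the first vote.

-- A test for inequality: both truncated differences vanish exactly when the values agree.
differ : Expr → Expr → Expr
differ d e = (d ⊝ e) ⊕ (e ⊝ d)

-- An encoded vote occupies one cell if empty and two if it ranks a candidate, hence the two ways to
-- advance register 2.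
scanVote : Program
scanVote =
  set 3 (reg 3 ⊝ lit 1) ⨾
  cond (load (reg 2))
    (cond (differ (load (lit 1 ⊕ reg 2)) (reg 4)) skip (set 1 (lit 1 ⊕ reg 1)) ⨾
     set 2 (lit 2 ⊕ reg 2))
    (set 2 (lit 1 ⊕ reg 2))

tally : Program
tally = set 1 (lit 0) ⨾ set 2 (reg 9) ⨾ set 3 (reg 8) ⨾ while (reg 3) scanVote

-- `member` tests whether the candidate in register 4 belongs to `C`. Lowering register 4 first
-- makes a loop started at `m` visit `m - 1` down to 0.
checkCandidate : Expr → Program
checkCandidate member =
  set 4 (reg 4 ⊝ lit 1) ⨾
  tally ⨾
  cond member (cond (reg 5 ⊝ reg 1) skip (set 6 (lit 1 ⊕ reg 6))) skip

-- Without votes the budget is constant and forbids a loop over the candidates; register 6 then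
-- keeps the result preset by the caller.
decide : Expr → Program
decide member =
  cond (reg 8)
    (set 4 (load (lit 1)) ⨾
     tally ⨾
     set 5 (reg 1) ⨾
     set 6 (lit 0) ⨾
     set 4 (load (lit 0)) ⨾
     while (reg 4) (checkCandidate member))
    skip ⨾
  set 0 (lit 1 ⊝ (reg 6 ⊝ reg 7))

-- Correctness and cost of the tally

record Frame (σ τ : State) : Set where
  constructor frame
  field
    mem-same  : mem τ ≡ mem σ
    -- Only registers below 4 are scratch; the form `4 + r` lets updates of them disappear by
    -- computation.
    regs-same : ∀ r → regs τ (4 + r) ≡ regs σ (4 + r)

open Frame

frame-trans : ∀ {σ τ υ} → Frame σ τ → Frame τ υ → Frame σ υ
frame-trans (frame m r) (frame m′ r′) = frame (trans m′ m) λ i → trans (r′ i) (r i)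

differ-≡ : ∀ {x y} → x ≡ y → (x ∸ y) + (y ∸ x) ≡ 0
differ-≡ {x} refl = cong₂ _+_ (n∸n≡0 x) (n∸n≡0 x)

differ-≢ : ∀ {x y} → x ≢ y → (x ∸ y) + (y ∸ x) ≢ 0
differ-≢ {x} {y} x≢y d≡0 = x≢y (≤-antisym
  (m∸n≡0⇒m≤n (m+n≡0⇒m≡0 (x ∸ y) d≡0)) (m∸n≡0⇒m≤n (m+n≡0⇒n≡0 (x ∸ y) d≡0)))

Scanned : ∀ {m} → Vote m → List ℕ → State → State → Set
Scanned v xs σ τ =
  Frame σ τ
  × Stored (mem τ) (regs τ 2) xs
  × regs τ 1 ≡ tops (regs σ 4) v + regs σ 1
  × regs τ 3 ≡ regs σ 3 ∸ 1

runs-scanVote : (v : Vote m) → voteLength v ≤ 1 → ∀ {xs} σ →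
  Stored (mem σ) (regs σ 2) (encodeVote v ++ xs) → Runs scanVote σ 29 (Scanned v xs σ)
runs-scanVote (vote [] _) _ σ st =
  -- The branch for a ranked candidate costs 22 steps; the branch for an empty vote, of 4, is padded
  -- to that.
  runs-set-⨾ (runs-else (cell st 0) (runs-≤ (≤ᵇ⇒≤ 4 22 tt) (runs-set
    (frame refl (λ _ → refl) , stored-tail st , refl , refl))))
runs-scanVote (vote (_ ∷ _ ∷ _) _) (s≤s ())
runs-scanVote (vote (d ∷ []) _) _ σ st with toℕ d ≟ regs σ 4
... | yes d≡c = runs-set-⨾ (runs-then (λ eq → 1+n≢0 (trans (sym (cell st 0)) eq))
  -- The intermediate assertion names the exact state, so the rest holds by computation.
  (runs-⨾ {P = assign (assign σ 3 (reg 3 ⊝ lit 1)) 1 (lit 1 ⊕ reg 1) ≡_}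
    (runs-else (differ-≡ (trans (cell st 1) d≡c)) (runs-set refl))
    λ { _ refl → runs-set
      (frame refl (λ _ → refl) , stored-tail (stored-tail st) , refl , refl) }))
... | no d≢c = runs-set-⨾ (runs-then (λ eq → 1+n≢0 (trans (sym (cell st 0)) eq))
  (runs-⨾ {P = assign σ 3 (reg 3 ⊝ lit 1) ≡_}
    (runs-then (differ-≢ (λ eq → d≢c (trans (sym (cell st 1)) eq))) (runs-≤ (≤ᵇ⇒≤ 1 4 tt) (runs-skip refl)))
    λ { _ refl → runs-set
      (frame refl (λ _ → refl) , stored-tail (stored-tail st) , refl , refl) }))

-- Each vote costs 29 steps plus 2 for the loop test; the last, failing test costs 2 more.
runs-scanVotes : (W : Profile m) → Truncated 1 W → ∀ σ →
  Stored (mem σ) (regs σ 2) (concatMap encodeVote W) → regs σ 3 ≡ length W →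
  Runs (while (reg 3) scanVote) σ (2 + length W * 31)
    (λ τ → Frame σ τ × regs τ 1 ≡ votesFor (regs σ 4) W + regs σ 1)
runs-scanVotes []      _        σ _  left = runs-exit left (frame refl (λ _ → refl) , refl)
runs-scanVotes (v ∷ W) (t ∷ ts) σ st left =
  runs-loop (λ eq → 1+n≢0 (trans (sym left) eq)) (runs-scanVote v t σ st)
    λ τ (fr , st′ , tal , left′) → runs-map
      (λ υ (fr′ , tal′) → frame-trans fr fr′ , (begin
        regs υ 1                              ≡⟨ tal′ ⟩
        votesFor (regs τ 4) W + regs τ 1      ≡⟨ cong₂ (λ i j → votesFor i W + j) (regs-same fr 0) tal ⟩
        votesFor i W + (tops i v + regs σ 1)  ≡⟨ x∙yz≈yx∙z (votesFor i W) (tops i v) (regs σ 1) ⟩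
        tops i v + votesFor i W + regs σ 1    ∎))
      (runs-scanVotes W ts τ st′ (trans left′ (cong (_∸ 1) left)))
  where
  open ≡-Reasoning
  i = regs σ 4

runs-tally : (V : Profile m) → Truncated 1 V → ∀ σ →
  Stored (mem σ) (regs σ 9) (concatMap encodeVote V) → regs σ 8 ≡ length V →
  Runs tally σ (8 + length V * 31) (λ τ → Frame σ τ × regs τ 1 ≡ votesFor (regs σ 4) V)
runs-tally V ts σ st n≡ = runs-set-⨾ (runs-set-⨾ (runs-set-⨾ (runs-map
  (λ τ (fr , tal) → frame (mem-same fr) (regs-same fr) , trans tal (+-identityʳ _))
  (runs-scanVotes V ts _ st n≡))))

-- Counting the threats

isThreat : Profile m → (ℕ → ℕ) → ℕ → ℕ → Bool
isThreat V member p i = (0 <ᵇ member i) ∧ (votesFor p V ≤ᵇ votesFor i V)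

count : (ℕ → Bool) → ℕ → ℕ
count f zero    = 0
count f (suc k) = (if f k then 1 else 0) + count f k

-- The candidate loop runs downwards, whereas subsets are counted from the front.
∣tabulate∣≡count : ∀ m (f : ℕ → Bool) → ∣ tabulate {n = m} (f ∘ toℕ) ∣ ≡ count f m
∣tabulate∣≡count zero    f = refl
∣tabulate∣≡count (suc m) f = trans (front (f 0) (tabulate {n = m} (f ∘ suc ∘ toℕ))) (trans (cong ((if f 0 then 1 else 0) +_)
  (∣tabulate∣≡count m (f ∘ suc))) (sym (count-front m)))
  where
  front : ∀ b {n} (S : Subset n) → ∣ b ∷ S ∣ ≡ (if b then 1 else 0) + ∣ S ∣
  front true  _ = refl
  front false _ = refl
  count-front : ∀ k → count f (suc k) ≡ (if f 0 then 1 else 0) + count (f ∘ suc) k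
  count-front zero    = refl
  count-front (suc k) = trans (cong (last +_) (count-front k))
    (x∙yz≈y∙xz last (if f 0 then 1 else 0) (count (f ∘ suc) k))
    where last = if f (suc k) then 1 else 0

-- The left side is 28 + 31n + (23 + c)m + 31nm. As `n` and `m` are positive, both are at most nm,
-- and 28 + 31 + 23 + 31 = 113.
decide-bound : ∀ {n m} c → 1 ≤ n → 1 ≤ m →
  1 + (1 + (3 + (8 + n * 31 + (2 + (2 + (3 + (2 + m * (2 + (4 + (8 + n * 31 + (9 + c))))))))))) + 6
    ≤ (113 + c) * (1 + n * m)
decide-bound {n} {m} c 1≤n 1≤m = begin
  1 + (1 + (3 + (8 + n * 31 + (2 + (2 + (3 + (2 + m * (2 + (4 + (8 + n * 31 + (9 + c))))))))))) + 6
    ≡⟨ solve 3 (λ n m c →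
         con 1 :+ (con 1 :+ (con 3 :+ (con 8 :+ n :* con 31 :+ (con 2 :+ (con 2 :+ (con 3 :+ (con 2 :+
           m :* (con 2 :+ (con 4 :+ (con 8 :+ n :* con 31 :+ (con 9 :+ c))))))))))) :+ con 6
         := n :* con 31 :+ m :* (con 23 :+ c) :+ (con 28 :+ n :* m :* con 31)) refl n m c ⟩
  n * 31 + m * (23 + c) + (28 + n * m * 31)
    ≤⟨ +-monoˡ-≤ _ (+-mono-≤ (*-monoˡ-≤ 31 n≤nm) (*-monoˡ-≤ (23 + c) m≤nm)) ⟩
  n * m * 31 + n * m * (23 + c) + (28 + n * m * 31)
    -- This slack raises both the constant term and the coefficient of `n * m` to 113 + c.
    ≤⟨ m≤m+n _ (85 + c + 28 * (n * m)) ⟩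
  n * m * 31 + n * m * (23 + c) + (28 + n * m * 31) + (85 + c + 28 * (n * m))
    ≡⟨ solve 2 (λ q c → q :* con 31 :+ q :* (con 23 :+ c) :+ (con 28 :+ q :* con 31) :+ (con 85 :+ c :+ con 28 :* q)
         := (con 113 :+ c) :* (con 1 :+ q)) refl (n * m) c ⟩
  (113 + c) * (1 + n * m) ∎
  where
  open ≤-Reasoning
  open +-*-Solver
  n≤nm : n ≤ n * m
  n≤nm = m≤m*n n m {{>-nonZero 1≤m}}
  m≤nm : m ≤ n * m
  m≤nm = m≤n*m m n {{>-nonZero 1≤n}}

-- The loop over the candidates and the total cost

module _ (V : Profile m) (ts : Truncated 1 V) (M : ℕ → ℕ) (a : ℕ)
         (st : Stored M a (concatMap encodeVote V))
         (member : Expr) (memberAt : ℕ → ℕ)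
         (eval-member : ∀ σ → mem σ ≡ M → eval σ member ≡ memberAt (regs σ 4)) (p : ℕ) where

  threat? : ℕ → Bool
  threat? = isThreat V memberAt p

  record Ready (σ : State) : Set where
    constructor ready
    field
      mem≡ : mem σ ≡ M
      n≡   : regs σ 8 ≡ length V
      a≡   : regs σ 9 ≡ a

  open Ready

  ready-frame : ∀ {σ τ} → Ready σ → Frame σ τ → Ready τ
  ready-frame (ready m n a) (frame fm fr) =
    ready (trans fm m) (trans (fr 4) n) (trans (fr 5) a)

  runs-tally-ready : ∀ σ → Ready σ →
    Runs tally σ (8 + length V * 31) (λ τ → Frame σ τ × regs τ 1 ≡ votesFor (regs σ 4) V)
  runs-tally-ready σ (ready refl n≡ refl) = runs-tally V ts σ st n≡

  -- Loop invariant: at the loop test, the candidates below `i` remain to be examined, `r` is the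
  -- count so far and `l` the limit.
  record Checked (i r l : ℕ) (τ : State) : Set where
    constructor checked
    field
      isReady    : Ready τ
      candidate≡ : regs τ 4 ≡ i
      own≡       : regs τ 5 ≡ votesFor p V
      result≡    : regs τ 6 ≡ r
      limit≡     : regs τ 7 ≡ l

  runs-judge : ∀ {i r l} τ → Checked i r l τ → regs τ 1 ≡ votesFor i V →
    Runs (cond member (cond (reg 5 ⊝ reg 1) skip (set 6 (lit 1 ⊕ reg 6))) skip) τ (9 + cost member)
      (Checked i ((if threat? i then 1 else 0) + r) l)
  runs-judge {i} {r} {l} τ (checked rd refl own refl refl) tal = runs-≤ (≤-reflexive bound) judge
    where
    bound : 1 + (cost member + 8) ≡ 9 + cost member
    bound = cong suc (+-comm (cost member) 8)
    member≡ : eval τ member ≡ memberAt i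
    member≡ = eval-member τ (mem≡ rd)
    judge : Runs (cond member (cond (reg 5 ⊝ reg 1) skip (set 6 (lit 1 ⊕ reg 6))) skip) τ
      (1 + (cost member + 8)) (Checked i ((if threat? i then 1 else 0) + r) l)
    -- Abstracting the bit, and then the comparison, makes `threat? i` in the postcondition compute.
    judge with memberAt i | member≡
    ... | zero  | mb = runs-else mb (runs-≤ (≤ᵇ⇒≤ 1 8 tt) (runs-skip (checked rd refl own refl refl)))
    ... | suc _ | mb with votesFor p V ≤ᵇ votesFor i V in eq
    ...   | true  = runs-then (λ eq → 1+n≢0 (trans (sym mb) eq))
      (runs-else (trans (cong₂ _∸_ own tal) (m≤n⇒m∸n≡0 (≤ᵇ⇒≤ (votesFor p V) (votesFor i V) (subst T (sym eq) tt))))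
        (runs-set (checked (ready (mem≡ rd) (n≡ rd) (a≡ rd)) refl own refl refl)))
    ...   | false = runs-then (λ eq → 1+n≢0 (trans (sym mb) eq))
      (runs-then (λ d≡0 → subst T eq (≤⇒≤ᵇ (m∸n≡0⇒m≤n {votesFor p V} (trans (sym (cong₂ _∸_ own tal)) d≡0))))
        (runs-≤ (≤ᵇ⇒≤ 1 4 tt) (runs-skip (checked rd refl own refl refl))))

  runs-checkCandidate : ∀ {i r l} σ → Checked (suc i) r l σ →
    Runs (checkCandidate member) σ (4 + (8 + length V * 31 + (9 + cost member)))
      (Checked i ((if threat? i then 1 else 0) + r) l)
  runs-checkCandidate σ (checked rd cand own res lim) =
    runs-set-⨾ (runs-⨾ (runs-tally-ready _ rd′)
      λ τ (fr , tal) → runs-judge τ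
        (checked (ready-frame rd′ fr) (trans (regs-same fr 0) cand′) (trans (regs-same fr 1) own)
          (trans (regs-same fr 2) res) (trans (regs-same fr 3) lim))
        (trans tal (cong (λ i → votesFor i V) cand′)))
    where
    rd′ : Ready (assign σ 4 (reg 4 ⊝ lit 1))
    rd′ = ready (mem≡ rd) (n≡ rd) (a≡ rd)
    cand′ = cong (_∸ 1) cand

  perCandidate : ℕ
  perCandidate = 2 + (4 + (8 + length V * 31 + (9 + cost member)))

  -- The round entered with `suc i` in register 4 examines candidate `i`, just as `count` peels off
  -- the largest index.
  runs-checkCandidates : ∀ i {r l} σ → Checked i r l σ →
    Runs (while (reg 4) (checkCandidate member)) σ (2 + i * perCandidate)
      (Checked 0 (count threat? i + r) l)
  runs-checkCandidates zero    σ ch = runs-exit (Checked.candidate≡ ch) ch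
  runs-checkCandidates (suc i) {r} {l} σ ch = runs-≤ (≤-reflexive bound)
    (runs-loop (λ eq → 1+n≢0 (trans (sym (Checked.candidate≡ ch)) eq)) (runs-checkCandidate σ ch)
      λ τ ch′ → runs-map
        (λ υ → subst (λ r → Checked 0 r l υ) (x∙yz≈yx∙z (count threat? i) b r))
        (runs-checkCandidates i τ ch′))
    where
    b = if threat? i then 1 else 0
    k = 4 + (8 + length V * 31 + (9 + cost member))
    bound : 2 + (k + (2 + i * perCandidate)) ≡ 2 + (2 + k + i * perCandidate)
    bound = cong (2 +_) (x∙yz≈yx∙z k 2 (i * perCandidate))

  runs-decide : ∀ σ → Ready σ → M 0 ≡ m → M 1 ≡ p → 1 ≤ m →
    (length V ≡ 0 → regs σ 6 ≡ count threat? m) →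
    Runs (decide member) σ ((113 + cost member) * (1 + length V * m))
      (λ τ → regs τ 0 ≡ 1 ∸ (count threat? m ∸ regs σ 7))
  runs-decide σ rd m≡ p≡ 1≤m no-votes with length V ≟ 0
  -- Without votes 3 steps pass the conditional and 6 write the answer.
  ... | yes n≡0 = runs-≤ (*-mono-≤ {9} {113 + cost member} {1} (m≤m+n 9 _) (s≤s z≤n))
    (runs-⨾ {P = σ ≡_} (runs-else (trans (n≡ rd) n≡0) (runs-skip refl))
      λ { _ refl → runs-set (cong (λ r → 1 ∸ (r ∸ regs σ 7)) (no-votes n≡0)) })
  ... | no n≢0 = runs-≤ (decide-bound (cost member) (n≢0⇒n>0 n≢0) 1≤m)
    (runs-⨾ (runs-then (λ eq → n≢0 (trans (sym (n≡ rd)) eq))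
      (runs-set-⨾ (runs-⨾ (runs-tally-ready _ (ready (mem≡ rd) (n≡ rd) (a≡ rd)))
        λ τ (fr , tal) → let rd′ = ready-frame (ready (mem≡ rd) (n≡ rd) (a≡ rd)) fr in
          runs-set-⨾ (runs-set-⨾ (runs-set-⨾ (runs-checkCandidates m _
            (checked (ready (mem≡ rd′) (n≡ rd′) (a≡ rd′)) (trans (cong (λ M → M 0) (mem≡ rd′)) m≡)
              (trans tal (cong (λ i → votesFor i V) (trans (cong (λ M → M 1) (mem≡ rd)) p≡)))
              refl (regs-same fr 3))))))))
      λ τ ch → runs-set (cong₂ (λ r l → 1 ∸ (r ∸ l))
        (trans (Checked.result≡ ch) (+-identityʳ _)) (Checked.limit≡ ch)))

-- From the count to the answer, and the two programs

threats-tabulate : (V : Profile m) (C : Subset m) (p : Fin m) (memberAt : ℕ → ℕ) →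
  (∀ c → memberAt (toℕ c) ≡ (if lookup C c then 1 else 0)) →
  Threats V C p (tabulate (isThreat V memberAt (toℕ p) ∘ toℕ))
threats-tabulate V C p memberAt member≡ .threat c = mk⇔ sound complete
  where
  f = isThreat V memberAt (toℕ p) ∘ toℕ
  inside⇒T : ∀ {S : Subset _} → c ∈ S → T (lookup S c)
  inside⇒T c∈S = Equivalence.from T-≡ ([]=⇒lookup c∈S)
  T⇒inside : ∀ {S : Subset _} → T (lookup S c) → c ∈ S
  T⇒inside {S} t = lookup⇒[]= c S (Equivalence.to T-≡ t)
  bit⇒ : ∀ b → T (0 <ᵇ (if b then 1 else 0)) → T b
  bit⇒ true _ = tt
  ⇒bit : ∀ b → T b → T (0 <ᵇ (if b then 1 else 0))
  ⇒bit true _ = tt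
  sound : c ∈ tabulate f → c ∈ C × votesFor (toℕ p) V ≤ votesFor (toℕ c) V
  sound c∈B with Equivalence.to T-∧ (subst T (lookup∘tabulate f c) (inside⇒T c∈B))
  ... | mem , p≤c = T⇒inside (bit⇒ _ (subst (λ k → T (0 <ᵇ k)) (member≡ c) mem)) , ≤ᵇ⇒≤ _ _ p≤c
  complete : c ∈ C × votesFor (toℕ p) V ≤ votesFor (toℕ c) V → c ∈ tabulate f
  complete (c∈C , p≤c) = T⇒inside (subst T (sym (lookup∘tabulate f c)) (Equivalence.from T-∧
    (subst (λ k → T (0 <ᵇ k)) (sym (member≡ c)) (⇒bit _ (inside⇒T c∈C)) , ≤⇒≤ᵇ p≤c)))

accept⇔ : ∀ x l → 1 ∸ (x ∸ l) ≡ 1 ⇔ x ≤ l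
accept⇔ x l = mk⇔ (λ eq → m∸n≡0⇒m≤n (1∸≡1 (x ∸ l) eq)) (λ x≤l → cong (1 ∸_) (m≤n⇒m∸n≡0 x≤l))
  where
  1∸≡1 : ∀ y → 1 ∸ y ≡ 1 → y ≡ 0
  1∸≡1 zero    _ = refl
  1∸≡1 (suc y) eq = contradiction (trans (sym (0∸n≡0 y)) eq) λ ()

-- Absorbs the constant set-up cost `a` into the factor.
+-absorb-≤ : ∀ a b q → a + b * (1 + q) ≤ (a + b) * (1 + q)
+-absorb-≤ a b q = ≤-trans (+-monoˡ-≤ (b * (1 + q)) (m≤m*n a (1 + q)))
  (≤-reflexive (sym (*-distribʳ-+ (1 + q) a b)))

solved : ∀ {x l : ℕ} {A : Set} → (A ⇔ x ≤ l) →
  Runs s σ K (λ τ → regs τ 0 ≡ 1 ∸ (x ∸ l)) → ∃[ k ] ∃[ τ ] (⟨ s , σ ⟩⇓[ k ] τ × k ≤ K × (regs τ 0 ≡ 1 ⇔ A))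
solved {x = x} {l} A⇔ (k , τ , run , k≤K , out) = k , τ , run , k≤K ,
  mk⇔ (λ eq → Equivalence.from A⇔ (Equivalence.to (accept⇔ x l) (trans (sym out) eq)))
      (λ a → trans out (Equivalence.from (accept⇔ x l) (Equivalence.to A⇔ a)))

-- Cells 0 to 3 hold `m`, `p`, `ℓ` and the size of `C`; the bits of `C` start at 4, the number of
-- votes is at `4 + m` and the votes follow. Steps: 16 for the set-up, and 113 + 4 from `decide`,
-- where 4 is the cost of `member`.
ccac-solvable : ∀ δ → SolvableInO (CCAC 1 δ) (λ I → CCACInstance.n I * CCACInstance.m I)
ccac-solvable δ = program , 133 , correct
  where
  member : Expr
  member = load (reg 4 ⊕ lit 4)
  program : Program
  program =
    set 8 (load (lit 4 ⊕ load (lit 0))) ⨾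
    set 9 (lit 5 ⊕ load (lit 0)) ⨾
    set 6 (load (lit 3)) ⨾
    set 7 (lit 1) ⨾
    decide member
  correct : (I : CCACInstance 1) → _
  correct I = solved (ccac-yes⇔ δ I threats) (runs-≤ (+-absorb-≤ 16 117 (n * m₀))
    (runs-set-⨾ (runs-set-⨾ (runs-set-⨾ (runs-set-⨾ (runs-map (λ _ → subst (λ x → _ ≡ 1 ∸ (x ∸ 1)) (sym size))
      (runs-decide V truncated M (5 + m₀) (stored-tail st) member memberAt (λ { _ refl → refl }) (toℕ p) _
        (ready refl (cell st 0) refl) refl refl (≤-<-trans z≤n (Fin.toℕ<n p))
        λ n≡0 → trans (sym (no-votes⇒∣B∣≡∣C∣ p∈C threats n≡0)) size)))))))
    where
    open CCACInstance I renaming (m to m₀)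
    M : ℕ → ℕ
    M = fetch (Problem.encode (CCAC 1 δ) I)
    bits : List ℕ
    bits = map (λ b → if b then 1 else 0) (toList C)
    st : Stored M (4 + m₀) (encodeProfile V)
    st = subst (λ k → Stored M k (encodeProfile V))
      (trans (+-identityʳ _) (cong (4 +_) (trans (length-map _ (toList C)) (length-toList C))))
      (stored-++ (m₀ ∷ toℕ p ∷ ℓ ∷ ∣ C ∣ ∷ bits) (stored λ j → cong M (+-identityʳ j)))
    memberAt : ℕ → ℕ
    memberAt i = M (i + 4)
    threats : Threats V C p (tabulate (isThreat V memberAt (toℕ p) ∘ toℕ))
    threats = threats-tabulate V C p memberAt
      λ c → trans (cong M (+-comm (toℕ c) 4)) (fetch-bits C c)
    size = ∣tabulate∣≡count m₀ (isThreat V memberAt (toℕ p))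

-- Everyone is a candidate, so membership is the constant 1 and the preset result is `m`. The
-- constant is 13 for the set-up plus 113 + 1 from `decide`.
ccdc-solvable : ∀ δ → SolvableInO (CCDC 1 δ) (λ I → CCDCInstance.n I * CCDCInstance.m I)
ccdc-solvable δ = program , 127 , correct
  where
  program : Program
  program =
    set 8 (load (lit 3)) ⨾
    set 9 (lit 4) ⨾
    set 6 (load (lit 0)) ⨾
    set 7 (lit 1 ⊕ load (lit 2)) ⨾
    decide (lit 1)
  correct : (I : CCDCInstance 1) → _
  correct I = solved (ccdc-yes⇔ δ I threats) (runs-≤ (+-absorb-≤ 13 114 (n * m₀))
    (runs-set-⨾ (runs-set-⨾ (runs-set-⨾ (runs-set-⨾ (runs-map (λ _ → subst (λ x → _ ≡ 1 ∸ (x ∸ suc ℓ)) (sym size))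
      (runs-decide V truncated M 4 (stored λ j → cong M (+-comm j 4)) (lit 1) (λ _ → 1) (λ _ _ → refl) (toℕ p) _
        (ready refl refl refl) refl refl (≤-<-trans z≤n (Fin.toℕ<n p))
        λ n≡0 → trans (sym (trans (no-votes⇒∣B∣≡∣C∣ ∈⊤ threats n≡0) (∣⊤∣≡n m₀))) size)))))))
    where
    open CCDCInstance I renaming (m to m₀)
    M : ℕ → ℕ
    M = fetch (Problem.encode (CCDC 1 δ) I)
    threats : Threats V C p (tabulate (isThreat V (λ _ → 1) (toℕ p) ∘ toℕ))
    threats = threats-tabulate V C p (λ _ → 1)
      λ c → sym (cong (if_then 1 else 0) (lookup-replicate c inside))
    size = ∣tabulate∣≡count m₀ (isThreat V (λ _ → 1) (toℕ p))

theorem6 : (δ : Rule) →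
    SolvableInO (CCAC 1 δ) (λ I → CCACInstance.n I * CCACInstance.m I)
    × SolvableInO (CCDC 1 δ) (λ I → CCDCInstance.n I * CCDCInstance.m I)
theorem6 δ = ccac-solvable δ , ccdc-solvable δ
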